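{- Let $A$ be a commutative ring, $k\ge1$, $\vec s=(n_1,\dots,n_k)$ a tuple of positive integers, and $X_\bullet=X_\bullet(\vec s;A)$ the diagonal simplicial tensor module with its boundary $\partial$, shift-and-truncate homotopy $H$ and shifted depth filtration $\mathcal F^\bullet$. The differential $\partial$ and the homotopy $H$ preserve the shifted depth filtration (filtration degree $0$). For all $t\in\mathbb Z$: 1. for all $p\ge1$ and all $i\in\{0,\dots,p\}$, $d_i^p(\mathcal F^tX_p)\subseteq\mathcal F^tX_{p-1}$; 2. for all $p\ge0$, $H_p(\mathcal F^tX_p)\subseteq\mathcal F^tX_{p+1}$.
   Context: Notation: $[p]=\{0,\dots,p\}$. For a shape $\vec s=(n_1,\dots,n_k)$ put $n=\min(n_1,\dots,n_k)-1$, $M_a(p)=n_a-1-n+p$ (so $M_a(p)\ge p$) and $I_p=\prod_{a=1}^k[M_a(p)]$ for $p\ge 0$. Let $\delta_i^q:[q-1]\to[q]$ be the increasing injection missing $i$, and $\Delta_i^p=\prod_{a=1}^k\delta_i^{M_a(p)}:I_{p-1}\to I_p$ ($p\ge1$, $0\le i\le p$). The diagonal simplicial tensor module has $X_p=A^{I_p}$ (all functions $T:I_p\to A$) and faces $d_i^p(T)=T\circ\Delta_i^p$; the boundary is $\partial_p=\sum_{i=0}^p(-1)^id_i^p$ for $p\ge1$, with $\partial_0=0$ and $X_p=0$ for $p<0$. The shift-and-truncate homotopy $H_p:X_p\to X_{p+1}$ ($p\ge0$) is: $H_p(T)(m)=0$ if some $m_a=0$, and $H_p(T)(m)=T(m-\vec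 1)$ if all $m_a>0$, for $m\in I_{p+1}$, $\vec1=(1,\dots,1)$; $H_{ -1}=0$. The shifted depth filtration is, for $p\ge0$ and $t\in\mathbb Z$, $\mathcal F^tX_p=\{T\in X_p: T(m)=0\text{ unless }\min_a m_a\ge t+p\}$. -}

module Defs where

open import Algebra.Bundles using (CommutativeRing)
open import Data.Bool.Base using (if_then_else_)
open import Data.Fin.Base using (Fin; zero; toℕ; _↑ˡ_; punchIn; pinch)
open import Data.Integer.Base as ℤ using (ℤ; +_)
open import Data.Nat.Base using (ℕ; suc; _+_; _∸_; _⊓_)
open import Data.Nat.Properties using (_≟_)
open import Data.Vec.Base using (Vec; foldr₁)
open import Data.Vec.Relation.Unary.All as All using (All)
open import Data.Vec.Relation.Unary.Any using (any?)
open import Relation.Nullary.Decidable.Core using (does)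
open import Relation.Nullary.Negation.Core using (¬_)
open import Relation.Unary using (Pred)

minimum : ∀ {k} → Vec ℕ (suc k) → ℕ
minimum = foldr₁ _⊓_

module Index {k} (s : Vec ℕ (suc k)) where

  -- For an entry r of s this is (r - 1) - n with n = minimum s - 1.  When all
  -- entries of s are positive, none of the subtractions truncates.
  excess : ℕ → ℕ
  excess r = r ∸ 1 ∸ (minimum s ∸ 1)

  M : ℕ → ℕ → ℕ
  M p r = p + excess r

  -- A multi-index is a tuple, so propositional equality of multi-indices is
  -- componentwise, and Fin (suc q) is [q] = {0, …, q}.
  I : ℕ → Set
  I p = All (λ r → Fin (suc (M p r))) s

  coords : ∀ {p} → I p → Vec ℕ (suc k)
  coords = All.reduce toℕ

  -- δᵢ is punchIn i, where i ∈ [p + 1] is regarded as an element of [M (p + 1) r].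
  Δ : ∀ {p} → Fin (suc (suc p)) → I p → I (suc p)
  Δ i = All.map (λ {r} → punchIn (i ↑ˡ excess r))

  -- pinch zero is the truncated predecessor: it sends zero to zero and suc j to j.
  _-𝟏 : ∀ {p} → I (suc p) → I p
  _-𝟏 = All.map (pinch zero)

module TensorModule {c ℓ} (A : CommutativeRing c ℓ) {k} (s : Vec ℕ (suc k)) where

  open Index s public
  open CommutativeRing A using (Carrier; _≈_; _*_; -_; 0#; 1#; semiring)
  open import Algebra.Properties.Semiring.Exp semiring using (_^_)
  open import Algebra.Properties.Semiring.Sum semiring using (sum)

  X : ℕ → Set c
  X p = I p → Carrier

  -- Implicit p is the target degree: faces and boundary leave degrees ≥ 1 only, as X
  -- vanishes in negative degrees and the boundary on X 0 is zero.
  d : ∀ {p} → Fin (suc (suc p)) → X (suc p) → X p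
  d i T m = T (Δ i m)

  ∂ : ∀ {p} → X (suc p) → X p
  ∂ T m = sum (λ i → (- 1#) ^ toℕ i * d i T m)

  H : ∀ {p} → X p → X (suc p)
  H T m = if does (any? (_≟ 0) (coords m)) then 0# else T (m -𝟏)

  F : ℤ → ∀ p → Pred (X p) ℓ
  F t p T = ∀ m → ¬ (t ℤ.+ + p ℤ.≤ + minimum (coords m)) → T m ≈ 0#

{-# OPTIONS --safe #-}

-- A face map raises the minimum of a multi-index by at most one, while the shift by 𝟏
-- lowers a positive minimum by exactly one.  The bound t + p of the filtration moves by
-- one in the same direction, so t is preserved in both cases.

module Submission where

open import Defs
open import Algebra.Bundles using (CommutativeRing)
import Algebra.Properties.Semiring.Exp as Exp
import Algebra.Properties.Semiring.Sum as Sum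
open import Data.Fin.Base using (Fin; zero; suc; toℕ; punchIn; pinch; _↑ˡ_)
open import Data.Integer.Base as ℤ using (ℤ; +_)
import Data.Integer.Properties as ℤ
open import Data.Nat.Base using (ℕ; suc; pred; NonZero; _≤_; _⊓_; z≤n; s≤s; ≢-nonZero)
open import Data.Nat.Properties
  using (_≟_; ≤-refl; ⊓-mono-≤; ⊓-sel; mono-≤-distrib-⊓; pred-mono-≤; suc-pred)
open import Data.Product.Base using (_×_; _,_)
open import Data.Sum.Base using (inj₁; inj₂)
open import Data.Vec.Base using (Vec; []; _∷_)
import Data.Vec.Membership.Propositional as Membership
open import Data.Vec.Relation.Binary.Pointwise.Inductive using (Pointwise; []; _∷_)
open import Data.Vec.Relation.Unary.All as All using (All; []; _∷_)
open import Data.Vec.Relation.Unary.Any as Any using (Any; any?; here; there)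
open import Relation.Binary.Core using (Rel; REL)
open import Relation.Binary.PropositionalEquality
  using (_≡_; _≢_; refl; sym; trans; cong; cong₂; subst)
open import Relation.Nullary using (¬_; yes; no)
open import Relation.Unary using (Pred; _∈_; _⊆_)

-- Induction along the nonempty fold. `R` is kept general to serve both `x ≤ suc y`, for faces, and
-- `x ≡ pred y`, for the shift.
minimum-preserves : ∀ {ℓ} {R : Rel ℕ ℓ} →
  (∀ {a b x y} → R a b → R x y → R (a ⊓ x) (b ⊓ y)) →
  ∀ {k} {v w : Vec ℕ (suc k)} → Pointwise R v w → R (minimum v) (minimum w)
minimum-preserves ⊓-pres (r ∷ [])         = r
minimum-preserves ⊓-pres (r ∷ rs@(_ ∷ _)) = ⊓-pres r (minimum-preserves ⊓-pres rs)

minimum∈ : ∀ {k} (v : Vec ℕ (suc k)) → minimum v Membership.∈ v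
minimum∈ (x ∷ [])         = here refl
minimum∈ (x ∷ ys@(_ ∷ _)) with ⊓-sel x (minimum ys)
... | inj₁ eq = here eq
... | inj₂ eq = there (subst (Membership._∈ ys) (sym eq) (minimum∈ ys))

-- `Δ` and `_-𝟏` change the `Fin` bounds, so the multi-indices before and after have different
-- types; reading both off through `g` and `h` makes their entries comparable.
reduce-map-pointwise : ∀ {a p q b c r} {A : Set a} {B : Set b} {C : Set c}
  {P : Pred A p} {Q : Pred A q} {R : REL B C r}
  (f : P ⊆ Q) (g : ∀ {x} → Q x → B) (h : ∀ {x} → P x → C) →
  (∀ {x} (px : P x) → R (g (f px)) (h px)) →
  ∀ {n} {xs : Vec A n} (pxs : All P xs) →
  Pointwise R (All.reduce g (All.map f pxs)) (All.reduce h pxs)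
reduce-map-pointwise f g h r []         = []
reduce-map-pointwise f g h r (px ∷ pxs) = r px ∷ reduce-map-pointwise f g h r pxs

toℕ-punchIn-≤ : ∀ {n} (i : Fin (suc n)) (j : Fin n) → toℕ (punchIn i j) ≤ suc (toℕ j)
toℕ-punchIn-≤ zero    j       = ≤-refl
toℕ-punchIn-≤ (suc i) zero    = z≤n
toℕ-punchIn-≤ (suc i) (suc j) = s≤s (toℕ-punchIn-≤ i j)

toℕ-pinch-zero : ∀ {n} (j : Fin (suc (suc n))) → toℕ (pinch zero j) ≡ pred (toℕ j)
toℕ-pinch-zero zero    = refl
toℕ-pinch-zero (suc j) = refl

pred-distrib-⊓ : ∀ x y → pred (x ⊓ y) ≡ pred x ⊓ pred y
pred-distrib-⊓ = mono-≤-distrib-⊓ pred-mono-≤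

module _ {k} (s : Vec ℕ (suc k)) where

  open Index s

  minimum-Δ : ∀ {p} (i : Fin (suc (suc p))) (m : I p) →
    minimum (coords (Δ i m)) ≤ suc (minimum (coords m))
  -- Monotonicity of `_⊓_` is enough because `suc b ⊓ suc y` computes to `suc (b ⊓ y)`.
  minimum-Δ i m = minimum-preserves {R = λ x y → x ≤ suc y} ⊓-mono-≤
    (reduce-map-pointwise (λ {r} → punchIn (i ↑ˡ excess r)) toℕ toℕ
      (λ {r} → toℕ-punchIn-≤ (i ↑ˡ excess r)) m)

  minimum-shift : ∀ {p} (m : I (suc p)) →
    minimum (coords (m -𝟏)) ≡ pred (minimum (coords m))
  minimum-shift m = minimum-preserves {R = λ x y → x ≡ pred y}
    (λ {_} {b} {_} {y} e f → trans (cong₂ _⊓_ e f) (sym (pred-distrib-⊓ b y)))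
    (reduce-map-pointwise (pinch zero) toℕ toℕ toℕ-pinch-zero m)

  -- The minimum is attained at some coordinate, so it is positive when no coordinate is zero, and
  -- `pred` does not truncate there.
  suc-minimum-shift : ∀ {p} (m : I (suc p)) → ¬ Any (_≡ 0) (coords m) →
    suc (minimum (coords (m -𝟏))) ≡ minimum (coords m)
  suc-minimum-shift m ∄0 = trans (cong suc (minimum-shift m)) (suc-pred _ ⦃ ≢-nonZero min≢0 ⦄)
    where
    min≢0 : minimum (coords m) ≢ 0
    min≢0 min≡0 = ∄0 (Any.map (λ eq → trans (sym eq) min≡0) (minimum∈ (coords m)))

+-suc : ∀ t p → t ℤ.+ + suc p ≡ ℤ.suc (t ℤ.+ + p)
-- As `t` is an arbitrary integer the sum does not compute; commuting brings the natural number to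
-- the front, where `ℤ.suc-+` applies.
+-suc t p = trans (ℤ.+-comm t (+ suc p))
  (trans (ℤ.suc-+ p t) (cong ℤ.suc (ℤ.+-comm (+ p) t)))

≤-shift⁺ : ∀ t p {a} → t ℤ.+ + p ℤ.≤ + a → t ℤ.+ + suc p ℤ.≤ + suc a
≤-shift⁺ t p {a} le = subst (ℤ._≤ + suc a) (sym (+-suc t p)) (ℤ.suc-mono le)

≤-shift⁻ : ∀ t p {a} → t ℤ.+ + suc p ℤ.≤ + suc a → t ℤ.+ + p ℤ.≤ + a
≤-shift⁻ t p {a} le = subst (ℤ._≤ + a)
  (trans (cong ℤ.pred (+-suc t p)) (ℤ.pred-suc _)) (ℤ.pred-mono le)

module _ {c ℓ} (A : CommutativeRing c ℓ) {k} (s : Vec ℕ (suc k)) (t : ℤ) where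

  open TensorModule A s
  private module A = CommutativeRing A
  open Exp A.semiring using (_^_)
  open Sum A.semiring using (sum-cong-≋; sum-replicate-zero)

  -- By contraposition: were `Δ i m` deep enough to escape the vanishing condition on `T`, then `m`,
  -- whose minimum is at most one smaller, would meet the bound `t + p`, itself one smaller.
  d-preserves-F : ∀ p i (T : X (suc p)) → T ∈ F t (suc p) → d i T ∈ F t p
  d-preserves-F p i T T∈F m m-shallow = T∈F (Δ i m) λ Δm-deep →
    m-shallow (≤-shift⁻ t p (ℤ.≤-trans Δm-deep (ℤ.+≤+ (minimum-Δ s i m))))

  ∂-preserves-F : ∀ p (T : X (suc p)) → T ∈ F t (suc p) → ∂ T ∈ F t p
  -- Every face vanishes at this same `m`, so each signed summand is zero.
  ∂-preserves-F p T T∈F m m-shallow = A.trans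
    (sum-cong-≋ λ i → A.trans (A.*-congˡ (d-preserves-F p i T T∈F m m-shallow))
                           (A.zeroʳ ((A.- A.1#) ^ toℕ i)))
    (sum-replicate-zero (suc (suc p)))

  H-preserves-F : ∀ p (T : X p) → T ∈ F t p → H T ∈ F t (suc p)
  -- This is the test that `H` branches on, so its value reduces to `0#` in the first case and to
  -- `T (m -𝟏)` in the second.
  H-preserves-F p T T∈F m m-shallow with any? (_≟ 0) (coords m)
  ... | yes _ = A.refl
  ... | no ∄0 = T∈F (m -𝟏) λ shift-deep → m-shallow
    (subst (λ a → t ℤ.+ + suc p ℤ.≤ + a) (suc-minimum-shift s m ∄0) (≤-shift⁺ t p shift-deep))

mainTheorem7 : ∀ {c ℓ} (A : CommutativeRing c ℓ) {k : ℕ} (s : Vec ℕ (suc k)) → All NonZero s →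
    let open TensorModule A s in
    (t : ℤ) →
    (∀ p (i : Fin (suc (suc p))) (T : X (suc p)) → T ∈ F t (suc p) → d i T ∈ F t p)
    × (∀ p (T : X (suc p)) → T ∈ F t (suc p) → ∂ T ∈ F t p)
    × (∀ p (T : X p) → T ∈ F t p → H T ∈ F t (suc p))
mainTheorem7 A s _ t = d-preserves-F A s t , ∂-preserves-F A s t , H-preserves-F A s t
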